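{- Let $m \ge 3$ and let $V_0^{(0)}=\emptyset$ (every vertex of $P(m,1)$ has weight $1$). Then $$\mathcal{G}(\{P(m,1),V_0^{(0)}\}) = \mathrm{mex}\{x_1,x_2,\dots,x_{2m}\},$$ where $x_i = \mathcal{G}(\mathcal{H}_{m+1})$ for all $i \in \{1,2,\dots,2m\}$.
   Context: Toggle: Let $G$ be a finite simple graph, with $N[v]$ the closed neighborhood of $v$. A position $\{G,V_0\}$ consists of $G$ and a set $V_0\subseteq V(G)$ of vertices of weight $0$; all other vertices have weight $1$. Let $\sigma(v)$ be the sum of the weights of the vertices in $N[v]$. A legal move consists of choosing a vertex $v$ of weight $1$ and switching the weight ($0\leftrightarrow 1$) of every vertex of $N[v]$; it is allowed only if $\sigma(v)$ after the switch is strictly smaller than $\sigma(v)$ before it. Two players alternate legal moves; a player with no legal move loses. Nimbers: $\mathcal{G}(\mathcal{S})=\mathrm{mex}\{\mathcal{G}(\mathcal{S}') : \mathcal{S}' \text{ reachable from } \mathcal{S} \text{ by one legal move}\}$, where $\mathrm{mex}(T)$ is the least nonnegative integer not in the finite set $T$ (so $\mathrm{mex}(\emptyset)=0$). $\mathcal{L}_{2,m}$ is the $2\times m$ grid graph with vertices $v_{i,j}$, $0\le i\le 1$, $1\le j\le m$, with edges $v_{0,j}v_{1,j}$ and $v_{i,j}v_{i,j+1}$ ($1\le j<m$). For $m\ge 3$, $P(m,1)$ is the graph obtained from $\mathcal{L}_{2,m}$ by adding the edges $v_{0,1}v_{0,m}$ and $v_{1,1}v_{1,m}$. For $m\ge 4$,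 $\mathcal{H}_m=\{\mathcal{L}_{2,m},V_0\}$ with $V_0=\{v_{0,1},v_{0,m},v_{1,1},v_{1,2},v_{1,m-1},v_{1,m}\}$. -}

module Defs where

open import Level using (0ℓ)
open import Data.Bool.Base using (Bool; false; if_then_else_; not)
open import Data.Fin.Base using (Fin; toℕ)
import Data.Fin.Properties as Fin
open import Data.List.Base using (List; []; _∷_; map; filter; mapMaybe; allFin; cartesianProduct)
open import Data.List.Membership.Propositional using (_∈_; _∉_)
open import Data.List.Membership.Propositional.Properties using (∈-allFin; ∈-cartesianProduct⁺)
import Data.List.Membership.DecPropositional as DecMembership
import Data.List.Properties as List
open import Data.List.Relation.Unary.Any using (here; there)
open import Data.List.Relation.Unary.Unique.Propositional using (Unique)
open import Data.List.Relation.Unary.Unique.Propositional.Properties using (allFin⁺; cartesianProduct⁺)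
import Data.Maybe.Base as Maybe
open import Data.Nat.Base using (ℕ; zero; suc; _+_; _∸_; _≤_; _<_; s≤s)
open import Data.Nat.ListAction using (sum)
open import Data.Nat.Induction using (<-wellFounded)
import Data.Nat.Properties as ℕ
open import Data.Nat.Solver using (module +-*-Solver)
open import Data.Product.Base using (Σ; ∃; _×_; _,_; proj₁; proj₂)
open import Data.Product.Properties using (≡-dec)
open import Data.Sum.Base using (_⊎_; inj₁; inj₂)
open import Induction.WellFounded using (WellFounded; WfRec; module All; module FixPoint; module Subrelation)
open import Relation.Binary.Core using (Rel)
open import Relation.Binary.Definitions using (Decidable; DecidableEquality; Irreflexive; Symmetric)
import Relation.Binary.Construct.On as On
import Relation.Unary as Unary
open import Relation.Unary using (Pred)
open import Relation.Binary.PropositionalEquality using (_≡_; refl; sym; trans; cong; subst)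
open import Relation.Nullary using (¬_; Dec; yes; no; does)
open import Relation.Nullary.Decidable using (_×-dec_; _⊎-dec_; dec⇒maybe; dec-false)
open import Relation.Nullary.Negation using (contradiction)

IsMex : List ℕ → ℕ → Set
IsMex T n = n ∉ T × (∀ {k} → k < n → k ∈ T)

private
  ∈⇒≤sum : ∀ {k} {T : List ℕ} → k ∈ T → k ≤ sum T
  ∈⇒≤sum (here refl)           = ℕ.m≤m+n _ _
  ∈⇒≤sum {T = x ∷ _} (there p) = ℕ.≤-trans (∈⇒≤sum p) (ℕ.m≤n+m _ x)

  search : ∀ (T : List ℕ) fuel n → (∀ {k} → k < n → k ∈ T) → fuel + n ∉ T → ∃ (IsMex T)
  search T zero       n below n∉T = n , n∉T , below
  search T (suc fuel) n below top∉T with DecMembership._∈?_ ℕ._≟_ n T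
  ... | no n∉T  = n , n∉T , below
  ... | yes n∈T = search T fuel (suc n) below′ (subst (_∉ T) (sym (ℕ.+-suc fuel n)) top∉T)
    where
    below′ : ∀ {k} → k < suc n → k ∈ T
    below′ k<1+n with ℕ.m≤n⇒m<n∨m≡n (ℕ.≤-pred k<1+n)
    ... | inj₁ k<n  = below k<n
    ... | inj₂ refl = n∈T

mexExists : ∀ T → ∃ (IsMex T)
mexExists T = search T (suc (sum T)) 0 (λ ())
  (λ top∈T → ℕ.1+n≰n (ℕ.≤-trans (ℕ.≤-reflexive (cong suc (sym (ℕ.+-identityʳ _)))) (∈⇒≤sum top∈T)))

mex : List ℕ → ℕ
mex T = proj₁ (mexExists T)

record Graph : Set₁ where
  field
    Vertex   : Set
    _≟_      : DecidableEquality Vertex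
    vertices : List Vertex
    complete : ∀ v → v ∈ vertices
    unique   : Unique vertices
    _~_      : Rel Vertex 0ℓ
    _~?_     : Decidable _~_
    ~-sym    : Symmetric _~_
    ~-irrefl : Irreflexive _≡_ _~_

  _∈N[_] : Rel Vertex 0ℓ
  w ∈N[ v ] = w ≡ v ⊎ v ~ w

  _∈N[_]? : Decidable _∈N[_]
  w ∈N[ v ]? = (w ≟ v) ⊎-dec (v ~? w)

  N[_] : Vertex → List Vertex
  N[ v ] = filter (_∈N[ v ]?) vertices

-- The set V₀ of vertices of weight 0 is given by its characteristic
-- function.
record Position : Set₁ where
  constructor ⟨_,_⟩
  field
    graph : Graph
  open Graph graph public
  field
    V₀ : Vertex → Bool

  weight : Vertex → ℕ
  weight v = if V₀ v then 0 else 1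

  σ : Vertex → ℕ
  σ v = sum (map weight N[ v ])

  totalWeight : ℕ
  totalWeight = sum (map weight vertices)

open Position using (graph; Vertex; V₀; weight; σ; totalWeight; vertices)

switch : (S : Position) → Vertex S → Position
switch S v = record
  { graph = graph S
  ; V₀    = λ w → if does (w ∈N[ v ]?) then not (V₀ S w) else V₀ S w
  }
  where open Graph (graph S)

Legal : (S : Position) → Vertex S → Set
Legal S v = weight S v ≡ 1 × σ (switch S v) v < σ S v

legal? : ∀ S v → Dec (Legal S v)
legal? S v = (weight S v ℕ.≟ 1) ×-dec (σ (switch S v) v ℕ.<? σ S v)

-- S′ ◁ S : the position S′ is reachable from S by one legal move.
data _◁_ : Rel Position (Level.suc 0ℓ) where
  move : ∀ {S v} → Legal S v → switch S v ◁ S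

legalMoves : (S : Position) → List (Σ (Vertex S) (Legal S))
legalMoves S = mapMaybe (λ v → Maybe.map (v ,_) (dec⇒maybe (legal? S v))) (vertices S)

private
  balance : ∀ {A : Set} {P : Pred A 0ℓ} (P? : Unary.Decidable P) (f g : A → ℕ) →
            (∀ u → ¬ P u → f u ≡ g u) → ∀ us →
            sum (map f us) + sum (map g (filter P? us)) ≡
            sum (map g us) + sum (map f (filter P? us))
  balance P? f g f≡g [] = refl
  balance P? f g f≡g (u ∷ us) with P? u
  ... | no ¬Pu rewrite f≡g u ¬Pu =
    trans (ℕ.+-assoc (g u) _ _)
      (trans (cong (g u +_) (balance P? f g f≡g us)) (sym (ℕ.+-assoc (g u) _ _)))
  ... | yes _ =
    trans (swap (f u) _ (g u) _)
      (trans (cong ((g u + f u) +_) (balance P? f g f≡g us)) (sym (swap′ (g u) _ (f u) _)))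
    where
    open +-*-Solver
    swap : ∀ p q r s → (p + q) + (r + s) ≡ (r + p) + (q + s)
    swap = solve 4 (λ p q r s → (p :+ q) :+ (r :+ s) := (r :+ p) :+ (q :+ s)) refl
    swap′ : ∀ p q r s → (p + q) + (r + s) ≡ (p + r) + (q + s)
    swap′ = solve 4 (λ p q r s → (p :+ q) :+ (r :+ s) := (p :+ r) :+ (q :+ s)) refl

-- A move at v only changes weights inside N[ v ], so the total weight
-- drops by exactly as much as σ v does.
◁⇒totalWeight< : ∀ {S′ S} → S′ ◁ S → totalWeight S′ < totalWeight S
◁⇒totalWeight< {S = S} (move {v = v} (_ , σ′<σ)) =
  ℕ.+-cancelʳ-< (σ S v) (totalWeight S′) (totalWeight S)
    (ℕ.≤-<-trans (ℕ.≤-reflexive (balance (_∈N[ v ]?) (weight S′) (weight S) unchanged (vertices S)))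
                 (ℕ.+-monoʳ-< (totalWeight S) σ′<σ))
  where
  open Graph (graph S) using (_∈N[_]; _∈N[_]?)
  S′ = switch S v

  unchanged : ∀ u → ¬ (u ∈N[ v ]) → weight S′ u ≡ weight S u
  unchanged u u∉N rewrite dec-false (u ∈N[ v ]?) u∉N = refl

◁-wellFounded : WellFounded _◁_
◁-wellFounded =
  Subrelation.wellFounded ◁⇒totalWeight< (On.wellFounded totalWeight <-wellFounded)

𝒢-step : ∀ S → WfRec _◁_ (λ _ → ℕ) S → ℕ
𝒢-step S rec = mex (map (λ (_ , legal) → rec (move legal)) (legalMoves S))

𝒢 : Position → ℕ
𝒢 = All.wfRec ◁-wellFounded 0ℓ (λ _ → ℕ) 𝒢-step

𝒢-unfold : ∀ S → 𝒢 S ≡ mex (map (λ (v , _) → 𝒢 (switch S v)) (legalMoves S))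
𝒢-unfold S = FixPoint.unfold-wfRec ◁-wellFounded (λ _ → ℕ) 𝒢-step
  (λ S′ IH≡ → cong mex (List.map-cong (λ (_ , legal) → IH≡ (move legal)) (legalMoves S′))) {S}

Grid : ℕ → Set
Grid m = Fin 2 × Fin m

row : ∀ {m} → Grid m → ℕ
row (i , _) = toℕ i

-- Columns are numbered from 1.
col : ∀ {m} → Grid m → ℕ
col (_ , j) = suc (toℕ j)

-- The simple graph on Grid m with an edge uv whenever Edge u v or
-- Edge v u.
gridGraph : ∀ {m} (Edge : Rel (Grid m) 0ℓ) → Decidable Edge → Irreflexive _≡_ Edge → Graph
gridGraph {m} Edge edge? irrefl = record
  { Vertex   = Grid m
  ; _≟_      = ≡-dec Fin._≟_ Fin._≟_
  ; vertices = cartesianProduct (allFin 2) (allFin m)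
  ; complete = λ (i , j) → ∈-cartesianProduct⁺ (∈-allFin i) (∈-allFin j)
  ; unique   = cartesianProduct⁺ (allFin⁺ 2) (allFin⁺ m)
  ; _~_      = λ u v → Edge u v ⊎ Edge v u
  ; _~?_     = λ u v → edge? u v ⊎-dec edge? v u
  ; ~-sym    = λ { (inj₁ e) → inj₂ e ; (inj₂ e) → inj₁ e }
  ; ~-irrefl = λ { refl (inj₁ e) → irrefl refl e ; refl (inj₂ e) → irrefl refl e }
  }

Rung Rail Wrap LadderEdge PrismEdge : ∀ {m} → Rel (Grid m) 0ℓ
Rung u v       = col u ≡ col v × row u ≡ 0 × row v ≡ 1
Rail u v       = row u ≡ row v × suc (col u) ≡ col v
Wrap {m} u v   = row u ≡ row v × col u ≡ 1 × col v ≡ m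
LadderEdge u v = Rung u v ⊎ Rail u v
PrismEdge u v  = LadderEdge u v ⊎ Wrap u v

ladderEdge? : ∀ {m} → Decidable (LadderEdge {m})
ladderEdge? u v =
  ((col u ℕ.≟ col v) ×-dec (row u ℕ.≟ 0) ×-dec (row v ℕ.≟ 1)) ⊎-dec
  ((row u ℕ.≟ row v) ×-dec (suc (col u) ℕ.≟ col v))

prismEdge? : ∀ {m} → Decidable (PrismEdge {m})
prismEdge? {m} u v =
  ladderEdge? u v ⊎-dec
  ((row u ℕ.≟ row v) ×-dec (col u ℕ.≟ 1) ×-dec (col v ℕ.≟ m))

ladderEdge-irrefl : ∀ {m} → Irreflexive _≡_ (LadderEdge {m})
ladderEdge-irrefl refl (inj₁ (_ , r≡0 , r≡1)) = contradiction (trans (sym r≡0) r≡1) λ ()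
ladderEdge-irrefl refl (inj₂ (_ , 1+c≡c))     = ℕ.1+n≢n 1+c≡c

prismEdge-irrefl : ∀ {m} → 3 ≤ m → Irreflexive _≡_ (PrismEdge {m})
prismEdge-irrefl _ refl (inj₁ e) = ladderEdge-irrefl refl e
prismEdge-irrefl m≥3 refl (inj₂ (_ , c≡1 , c≡m)) =
  contradiction (subst (3 ≤_) (trans (sym c≡m) c≡1) m≥3) λ { (s≤s ()) }

ℒ₂ : ℕ → Graph
ℒ₂ m = gridGraph {m} LadderEdge ladderEdge? ladderEdge-irrefl

P[_,1] : (m : ℕ) → 3 ≤ m → Graph
P[ m ,1] m≥3 = gridGraph {m} PrismEdge prismEdge? (prismEdge-irrefl m≥3)

∅ : ∀ {V : Set} → V → Bool
∅ _ = false

ℋ : (m : ℕ) → 4 ≤ m → Position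
ℋ m _ = record
  { graph = ℒ₂ m
  ; V₀    = λ v → does ((row v , col v) ∈?
      ((0 , 1) ∷ (0 , m) ∷ (1 , 1) ∷ (1 , 2) ∷ (1 , m ∸ 1) ∷ (1 , m) ∷ []))
  }
  where open DecMembership (≡-dec ℕ._≟_ ℕ._≟_) using (_∈?_)

-- After any first move, the column s of the chosen vertex has weight 0,
-- and cutting the prism along s gives ℋ (suc m), with the two end
-- columns both lying over s.  Legality at a vertex of degree 3 means
-- weight 1 and at most one neighbor of weight 0.  Call a column dead once
-- a vertex in it has been played (in the ladder, the two ends are dead
-- from the start).  A dead column has weight 0; a live column with no dead
-- neighbor has weight 1 everywhere, and one with exactly one dead neighbor
-- contains a 0.  Hence a vertex in or next to a dead column always has too
-- many zeros around it to be played.  In particular the ends never change,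
-- so moves in the ladder and in the prism correspond throughout.
module Submission where

open import Defs
open import Level using (0ℓ)
open import Data.Bool.Base using (Bool; true; false; not; _∨_; if_then_else_)
open import Data.Bool.Properties using (∨-zeroʳ; ¬-not)
open import Data.Fin.Base using (Fin; zero; suc; toℕ; fromℕ; fromℕ<; inject₁; opposite)
import Data.Fin.Properties as Fin
open import Data.List.Base using (List; []; _∷_; map; mapMaybe; tabulate)
open import Data.List.Membership.Propositional using (_∈_)
open import Data.List.Membership.Propositional.Properties
  using (∈-map⁺; ∈-map⁻; ∈-filter⁺; ∈-filter⁻; ∈-tabulate⁺; ∈-tabulate⁻)
open import Data.List.Membership.Propositional.Properties.WithK using (unique∧set⇒bag)
import Data.List.Membership.DecPropositional as DecMembership
open import Data.List.Relation.Binary.BagAndSetEquality using (∼bag⇒↭)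
open import Data.List.Relation.Binary.Permutation.Propositional using (_↭_)
import Data.List.Relation.Binary.Permutation.Propositional.Properties as Perm
open import Data.List.Relation.Unary.All using ([]; _∷_)
open import Data.List.Relation.Unary.Any using (here; there)
open import Data.List.Relation.Unary.AllPairs using ([]; _∷_)
open import Data.List.Relation.Unary.Unique.Propositional using (Unique)
open import Data.List.Relation.Unary.Unique.Propositional.Properties using (filter⁺)
import Data.Maybe.Base as Maybe
open import Data.Maybe.Base using (Maybe; just; nothing)
open import Data.Nat.Base using (ℕ; zero; suc; _+_; _∸_; _*_; _≤_; _<_; z≤n; s≤s)
open import Data.Nat.ListAction using (sum)
open import Data.Nat.ListAction.Properties using (sum-↭)
import Data.Nat.Properties as ℕ
open import Data.Product.Base using (∃; ∃₂; _×_; _,_; proj₁; proj₂)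
open import Data.Product.Properties using (≡-dec)
open import Data.Sum.Base using (_⊎_; inj₁; inj₂)
open import Function.Base using (_∘_)
open import Function.Bundles using (mk⇔)
open import Induction.WellFounded using (Acc; acc)
open import Relation.Binary.Core using (Rel)
open import Relation.Binary.Definitions using (Decidable; Irreflexive)
open import Relation.Binary.PropositionalEquality
  using (_≡_; _≢_; refl; sym; trans; cong; cong₂; subst; subst₂)
open import Relation.Nullary using (¬_; Dec; yes; no; does)
open import Relation.Nullary.Decidable using (dec⇒maybe; dec-true; dec-false; _⊎-dec_)
open import Relation.Nullary.Negation using (contradiction)

open Position using (graph; V₀; σ)

-- Mex and Grundy values as functions of the set of options.

mex-⊆-≤ : ∀ {T U} → (∀ {k} → k ∈ T → k ∈ U) → mex T ≤ mex U
mex-⊆-≤ {T} {U} T⊆U with mexExists T | mexExists U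
... | t , _ , below | u , u∉U , _ = ℕ.≮⇒≥ λ u<t → u∉U (T⊆U (below u<t))

-- Lists of option values may thus be compared up to order and multiplicity.
mex-cong : ∀ {T U} → (∀ {k} → k ∈ T → k ∈ U) → (∀ {k} → k ∈ U → k ∈ T) → mex T ≡ mex U
mex-cong T⊆U U⊆T = ℕ.≤-antisym (mex-⊆-≤ T⊆U) (mex-⊆-≤ U⊆T)

∈-mapMaybe⁺ : ∀ {A B : Set} (f : A → Maybe B) {x y xs} →
              x ∈ xs → f x ≡ just y → y ∈ mapMaybe f xs
∈-mapMaybe⁺ f (here refl) fx≡y rewrite fx≡y = here refl
∈-mapMaybe⁺ f {xs = z ∷ _} (there p) fx≡y with f z
... | just _  = there (∈-mapMaybe⁺ f p fx≡y)
... | nothing = ∈-mapMaybe⁺ f p fx≡y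

module _ (S : Position) where
  private
    value : ∃ (Legal S) → ℕ
    value (v , _) = 𝒢 (switch S v)

  options : List ℕ
  options = map value (legalMoves S)

  -- The list `legalMoves S` stores the proof that `legal?` returns rather than the given one;
  -- `value` ignores the proof, so the option is the same.
  ∈-options⁺ : ∀ v → Legal S v → 𝒢 (switch S v) ∈ options
  ∈-options⁺ v legal =
    let legal′ , eq = found (legal? S v)
    in ∈-map⁺ value (∈-mapMaybe⁺ _ (Graph.complete (graph S) v) eq)
    where
    found : (l? : Dec (Legal S v)) →
            ∃ λ legal′ → Maybe.map (v ,_) (dec⇒maybe l?) ≡ just (v , legal′)
    found (yes legal′) = legal′ , refl
    found (no illegal) = contradiction legal illegal

  ∈-options⁻ : ∀ {k} → k ∈ options → ∃ λ v → Legal S v × k ≡ 𝒢 (switch S v)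
  ∈-options⁻ k∈ =
    let (v , legal) , _ , k≡ = ∈-map⁻ value k∈
    in v , legal , k≡

𝒢≡mex-options : ∀ S → 𝒢 S ≡ mex (options S)
𝒢≡mex-options = 𝒢-unfold

-- The vertex `v₀` makes the options nonempty and the index in `Fin n` does the same for the
-- constant list, so both have `x` as their only member.
𝒢-all-moves≡ : ∀ S v₀ → Legal S v₀ → ∀ x → (∀ v → 𝒢 (switch S v) ≡ x) →
               ∀ {n} → Fin n → 𝒢 S ≡ mex (tabulate {n = n} λ _ → x)
𝒢-all-moves≡ S v₀ legal x move≡x {n} i =
  trans (𝒢≡mex-options S) (mex-cong {options S} {xs} options⊆ ⊆options)
  where
  xs : List ℕ
  xs = tabulate {n = n} λ _ → x

  options⊆ : ∀ {k} → k ∈ options S → k ∈ xs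
  options⊆ k∈ =
    let v , _ , k≡ = ∈-options⁻ S k∈
    in subst (_∈ xs) (sym (trans k≡ (move≡x v))) (∈-tabulate⁺ i)

  ⊆options : ∀ {k} → k ∈ xs → k ∈ options S
  ⊆options k∈ =
    let _ , k≡x = ∈-tabulate⁻ {f = λ (_ : Fin n) → x} k∈
    in subst (_∈ options S) (trans (move≡x v₀) (sym k≡x)) (∈-options⁺ S v₀ legal)

-- Since mex sees only the set of values, matching each move with some move of equal value, in both
-- directions, suffices.
𝒢-cong : ∀ S S′ →
         (∀ v → Legal S v → ∃ λ v′ → Legal S′ v′ × 𝒢 (switch S v) ≡ 𝒢 (switch S′ v′)) →
         (∀ v′ → Legal S′ v′ → ∃ λ v → Legal S v × 𝒢 (switch S′ v′) ≡ 𝒢 (switch S v)) →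
         𝒢 S ≡ 𝒢 S′
𝒢-cong S S′ forth back =
  trans (𝒢≡mex-options S)
    (trans (mex-cong {options S} {options S′} (include S S′ forth) (include S′ S back))
           (sym (𝒢≡mex-options S′)))
  where
  include : ∀ T U → (∀ v → Legal T v → ∃ λ w → Legal U w × 𝒢 (switch T v) ≡ 𝒢 (switch U w)) →
            ∀ {k} → k ∈ options T → k ∈ options U
  include T U embed k∈ =
    let v , legal , k≡ = ∈-options⁻ T k∈
        w , legal′ , eq = embed v legal
    in subst (_∈ options U) (sym (trans k≡ eq)) (∈-options⁺ U w legal′)

module _ (S : Position) where
  open Graph (graph S)

  switch-∈ : ∀ {v w} → w ∈N[ v ] → V₀ (switch S v) w ≡ not (V₀ S w)
  switch-∈ {v} {w} w∈N rewrite dec-true (w ∈N[ v ]?) w∈N = refl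

  switch-∉ : ∀ {v w} → ¬ w ∈N[ v ] → V₀ (switch S v) w ≡ V₀ S w
  switch-∉ {v} {w} w∉N rewrite dec-false (w ∈N[ v ]?) w∉N = refl

-- Neighborhoods of degree 3 and legality in terms of four flags.

opposite-≢ : (i : Fin 2) → opposite i ≢ i
opposite-≢ zero       ()
opposite-≢ (suc zero) ()

≢⇒≡opposite : (i j : Fin 2) → i ≢ j → j ≡ opposite i
≢⇒≡opposite zero       zero       i≢j = contradiction refl i≢j
≢⇒≡opposite zero       (suc zero) i≢j = refl
≢⇒≡opposite (suc zero) zero       i≢j = refl
≢⇒≡opposite (suc zero) (suc zero) i≢j = contradiction refl i≢j

∃⇒row⊎opposite : ∀ {P : Fin 2 → Set} (i : Fin 2) → ∃ P → P i ⊎ P (opposite i)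
∃⇒row⊎opposite i (j , Pj) with i Fin.≟ j
... | yes refl = inj₁ Pj
... | no  i≢j with refl ← ≢⇒≡opposite i j i≢j = inj₂ Pj

-- The closed neighborhood of `(i , b)` when `a` and `c` are the columns before and after `b`. The
-- order is center, rung partner, previous, next; the arguments of `Favourable` follow it.
cross : ∀ {m} → Fin 2 → (a b c : Fin m) → List (Grid m)
cross i a b c = (i , b) ∷ (opposite i , b) ∷ (i , a) ∷ (i , c) ∷ []

wt : Bool → ℕ
wt z = if z then 0 else 1

-- Legality read off the four flags of a cross, where `true` stands for weight 0. A switch negates
-- all four, so the sum drops exactly when at most one flag is `true`.
record Favourable (p q r s : Bool) : Set where
  constructor _,_
  field
    chosen  : wt p ≡ 1
    smaller : sum (map (wt ∘ not) (p ∷ q ∷ r ∷ s ∷ [])) < sum (map wt (p ∷ q ∷ r ∷ s ∷ []))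

-- _↝_ is the successor relation on columns; ladder and prism differ only
-- in whether it is cyclic.
record Track {m} (Edge : Rel (Grid m) 0ℓ) : Set₁ where
  field
    _↝_          : Rel (Fin m) 0ℓ
    ↝-functional : ∀ {a b c} → a ↝ b → a ↝ c → b ≡ c
    ↝-injective  : ∀ {a b c} → a ↝ c → b ↝ c → a ≡ b
    ↝⇒≢          : ∀ {a b} → a ↝ b → a ≢ b
    ↝↝⇒≢         : ∀ {a b c} → a ↝ b → b ↝ c → a ≢ c
    Edge⇒        : ∀ {u v} → Edge u v →
                   Rung u v ⊎ (row u ≡ row v × (proj₂ u ↝ proj₂ v ⊎ proj₂ v ↝ proj₂ u))
    Rung⇒Edge    : ∀ {u v} → Rung u v → Edge u v
    ↝⇒Edge       : ∀ i {a b} → a ↝ b → Edge (i , a) (i , b) ⊎ Edge (i , b) (i , a)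

module Neighborhood {m} {Edge : Rel (Grid m) 0ℓ} (track : Track Edge)
                    (edge? : Decidable Edge) (irrefl : Irreflexive _≡_ Edge) where
  open Track track
  private
    G : Graph
    G = gridGraph Edge edge? irrefl
  open Graph G using (_~_; ~-sym; _∈N[_]; _∈N[_]?; N[_]; complete; unique)

  private
    Adjacent : Rel (Grid m) 0ℓ
    Adjacent (i , k) (i′ , k′) = (i′ ≡ opposite i × k′ ≡ k) ⊎ (i′ ≡ i × (k ↝ k′ ⊎ k′ ↝ k))

    Rung⇒Adjacent : ∀ {u v} → Rung u v → Adjacent u v × Adjacent v u
    Rung⇒Adjacent {zero , k} {suc zero , k′} (c≡c , _ , _) =
      let k≡k′ = Fin.toℕ-injective (ℕ.suc-injective c≡c)
      in inj₁ (refl , sym k≡k′) , inj₁ (refl , k≡k′)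

    ~⇒Adjacent : ∀ {u v} → u ~ v → Adjacent u v
    ~⇒Adjacent {u} {v} (inj₁ e) with Edge⇒ e
    ... | inj₁ rung           = proj₁ (Rung⇒Adjacent {u} {v} rung)
    ... | inj₂ (r≡r , step)   = inj₂ (sym (Fin.toℕ-injective r≡r) , step)
    ~⇒Adjacent {u} {v} (inj₂ e) with Edge⇒ e
    ... | inj₁ rung            = proj₂ (Rung⇒Adjacent {v} {u} rung)
    ... | inj₂ (r≡r , inj₁ s)  = inj₂ (Fin.toℕ-injective r≡r , inj₂ s)
    ... | inj₂ (r≡r , inj₂ s)  = inj₂ (Fin.toℕ-injective r≡r , inj₁ s)

  ∈N⇒row⊎column : ∀ {i b w} → w ∈N[ i , b ] →
                  proj₂ w ≡ b ⊎ (proj₁ w ≡ i × (b ↝ proj₂ w ⊎ proj₂ w ↝ b))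
  ∈N⇒row⊎column (inj₁ refl) = inj₁ refl
  ∈N⇒row⊎column (inj₂ v~w) with ~⇒Adjacent v~w
  ... | inj₁ (_ , k≡b) = inj₁ k≡b
  ... | inj₂ same      = inj₂ same

  ∈N-column : ∀ {i i′ b} → (i′ , b) ∈N[ i , b ]
  ∈N-column {zero}     {zero}     = inj₁ refl
  ∈N-column {zero}     {suc zero} = inj₂ (inj₁ (Rung⇒Edge (refl , refl , refl)))
  ∈N-column {suc zero} {zero}     = inj₂ (inj₂ (Rung⇒Edge (refl , refl , refl)))
  ∈N-column {suc zero} {suc zero} = inj₁ refl

  ∈N-next : ∀ {i b c} → b ↝ c → (i , c) ∈N[ i , b ]
  ∈N-next {i} b↝c = inj₂ (↝⇒Edge i b↝c)

  ∈N-previous : ∀ {i a b} → a ↝ b → (i , a) ∈N[ i , b ]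
  ∈N-previous {i} a↝b = inj₂ (~-sym (↝⇒Edge i a↝b))

  module _ {a b c : Fin m} (a↝b : a ↝ b) (b↝c : b ↝ c) where

    ∈cross⇒∈N : ∀ {i w} → w ∈ cross i a b c → w ∈N[ i , b ]
    ∈cross⇒∈N (here refl)                         = ∈N-column
    ∈cross⇒∈N (there (here refl))                 = ∈N-column
    ∈cross⇒∈N (there (there (here refl)))         = ∈N-previous a↝b
    ∈cross⇒∈N (there (there (there (here refl)))) = ∈N-next b↝c

    ∈N⇒∈cross : ∀ {i w} → w ∈N[ i , b ] → w ∈ cross i a b c
    ∈N⇒∈cross (inj₁ refl) = here refl
    ∈N⇒∈cross (inj₂ v~w) with ~⇒Adjacent v~w
    ... | inj₁ (refl , refl)       = there (here refl)
    ... | inj₂ (refl , inj₁ b↝k)   =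
      there (there (there (here (cong (_ ,_) (↝-functional b↝k b↝c)))))
    ... | inj₂ (refl , inj₂ k↝b)   = there (there (here (cong (_ ,_) (↝-injective k↝b a↝b))))

    cross-unique : ∀ i → Unique (cross i a b c)
    cross-unique i =
      ((λ eq → opposite-≢ i (sym (cong proj₁ eq))) ∷ (↝⇒≢ a↝b ∘ sym ∘ cong proj₂) ∷
       (↝⇒≢ b↝c ∘ cong proj₂) ∷ []) ∷
      ((opposite-≢ i ∘ cong proj₁) ∷ (opposite-≢ i ∘ cong proj₁) ∷ []) ∷
      ((↝↝⇒≢ a↝b b↝c ∘ cong proj₂) ∷ []) ∷ [] ∷ []

    -- Both lists are free of duplicates and have the same members. This turns `σ` into a sum of
    -- four weights, in ladder and prism alike.
    N↭cross : ∀ i → N[ i , b ] ↭ cross i a b c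
    N↭cross i = ∼bag⇒↭ (unique∧set⇒bag (filter⁺ _ unique) (cross-unique i)
      (mk⇔ (∈N⇒∈cross ∘ proj₂ ∘ ∈-filter⁻ (_∈N[ i , b ]?) {xs = Graph.vertices G})
           (λ w∈ → ∈-filter⁺ (_∈N[ i , b ]?) (complete _) (∈cross⇒∈N w∈))))

    module _ (f : Grid m → Bool) (i : Fin 2) where
      private
        S : Position
        S = ⟨ G , f ⟩

        σ-cross : ∀ h → σ ⟨ G , h ⟩ (i , b) ≡ sum (map (wt ∘ h) (cross i a b c))
        σ-cross h = sum-↭ (Perm.map⁺ (wt ∘ h) (N↭cross i))

        σ≡ : σ S (i , b) ≡ sum (map (wt ∘ f) (cross i a b c))
        σ≡ = σ-cross f

        switched : ∀ {w} → w ∈ cross i a b c → V₀ (switch S (i , b)) w ≡ not (f w)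
        switched = switch-∈ S ∘ ∈cross⇒∈N

        σ-switch≡ : σ (switch S (i , b)) (i , b) ≡ sum (map (wt ∘ not ∘ f) (cross i a b c))
        σ-switch≡ = trans (σ-cross (V₀ (switch S (i , b))))
          (cong₂ _+_ (cong wt (switched (here refl)))
          (cong₂ _+_ (cong wt (switched (there (here refl))))
          (cong₂ _+_ (cong wt (switched (there (there (here refl)))))
          (cong₂ _+_ (cong wt (switched (there (there (there (here refl)))))) refl))))

      Legal⇒Favourable : Legal S (i , b) →
                         Favourable (f (i , b)) (f (opposite i , b)) (f (i , a)) (f (i , c))
      Legal⇒Favourable (w≡1 , σ<) = w≡1 , subst₂ _<_ σ-switch≡ σ≡ σ<

      Favourable⇒Legal : Favourable (f (i , b)) (f (opposite i , b)) (f (i , a)) (f (i , c)) →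
                         Legal S (i , b)
      Favourable⇒Legal (w≡1 , σ<) = w≡1 , subst₂ _<_ (sym σ-switch≡) (sym σ≡) σ<

Favourable⇒¬p : ∀ {p q r s} → Favourable p q r s → p ≡ false
Favourable⇒¬p {false} _ = refl

-- With two neighbors of weight 0, at most two weights are 1 before the switch and at least two
-- after it, so the sum cannot drop. The next two lemmas treat the other pairs of neighbors.
Favourable⇒¬[q∧r] : ∀ {p q r s} → Favourable p q r s → q ≡ true → r ≢ true
Favourable⇒¬[q∧r] {false} {s = true}  (_ , s≤s ())         refl refl
Favourable⇒¬[q∧r] {false} {s = false} (_ , s≤s (s≤s ()))   refl refl

Favourable⇒¬[q∧s] : ∀ {p q r s} → Favourable p q r s → q ≡ true → s ≢ true
Favourable⇒¬[q∧s] {false} {r = true}  (_ , s≤s ())         refl refl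
Favourable⇒¬[q∧s] {false} {r = false} (_ , s≤s (s≤s ()))   refl refl

Favourable⇒¬[r∧s] : ∀ {p q r s} → Favourable p q r s → r ≡ true → s ≢ true
Favourable⇒¬[r∧s] {false} {true}  (_ , s≤s ())         refl refl
Favourable⇒¬[r∧s] {false} {false} (_ , s≤s (s≤s ()))   refl refl

Favourable-cong : ∀ {p p′ q q′ r r′ s s′} → p ≡ p′ → q ≡ q′ → r ≡ r′ → s ≡ s′ →
                  Favourable p q r s → Favourable p′ q′ r′ s′
Favourable-cong refl refl refl refl fav = fav

-- Column successors in the ladder and in the prism.

ladderTrack : ∀ {m} → Track (LadderEdge {m})
ladderTrack = record
  { _↝_          = λ a b → suc (toℕ a) ≡ toℕ b
  ; ↝-functional = λ a↝b a↝c → Fin.toℕ-injective (trans (sym a↝b) a↝c)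
  ; ↝-injective  = λ a↝c b↝c → Fin.toℕ-injective (ℕ.suc-injective (trans a↝c (sym b↝c)))
  ; ↝⇒≢          = λ { a↝a refl → ℕ.1+n≢n a↝a }
  ; ↝↝⇒≢         = λ { a↝b b↝a refl → ℕ.m≢1+n+m _ {1} (sym (trans (cong suc a↝b) b↝a)) }
  ; Edge⇒        = λ { (inj₁ rung)      → inj₁ rung
                     ; (inj₂ (r≡r , s)) → inj₂ (r≡r , inj₁ (ℕ.suc-injective s)) }
  ; Rung⇒Edge    = inj₁
  ; ↝⇒Edge       = λ _ a↝b → inj₁ (inj₂ (refl , cong suc a↝b))
  }

_↻_ : ∀ {m} → Rel (Fin m) 0ℓ
_↻_ {m} k k′ = suc (toℕ k) ≡ toℕ k′ ⊎ (toℕ k′ ≡ 0 × suc (toℕ k) ≡ m)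

prismTrack : ∀ {m} → 3 ≤ m → Track (PrismEdge {m})
prismTrack {m} m≥3 = record
  { _↝_          = _↻_
  ; ↝-functional = functional
  ; ↝-injective  = injective
  ; ↝⇒≢          = λ { (inj₁ s) refl → ℕ.1+n≢n s
                     ; (inj₂ (z , s)) refl → m≢ 1 (s≤s z≤n) (trans (cong suc (sym z)) s) }
  ; ↝↝⇒≢         = λ { {a} p q refl → two p q }
  ; Edge⇒        = λ { (inj₁ (inj₁ rung))        → inj₁ rung
                     ; (inj₁ (inj₂ (r≡r , s)))   → inj₂ (r≡r , inj₁ (inj₁ (ℕ.suc-injective s)))
                     -- A wrap edge is oriented from the first column to the last, against `_↻_`,
                     -- hence the backward alternative.
                     ; (inj₂ (r≡r , c≡1 , c≡m)) →
                         inj₂ (r≡r , inj₂ (inj₂ (ℕ.suc-injective c≡1 , c≡m))) }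
  ; Rung⇒Edge    = λ rung → inj₁ (inj₁ rung)
  ; ↝⇒Edge       = λ { _ (inj₁ s)       → inj₁ (inj₁ (inj₂ (refl , cong suc s)))
                     ; _ (inj₂ (z , s)) → inj₂ (inj₂ (refl , cong suc z , s)) }
  }
  where
  m≢ : ∀ n → n ≤ 2 → n ≢ m
  m≢ n n≤2 refl = ℕ.1+n≰n (ℕ.≤-trans m≥3 n≤2)

  functional : ∀ {a b c : Fin m} → a ↻ b → a ↻ c → b ≡ c
  functional         (inj₁ s)       (inj₁ t)       = Fin.toℕ-injective (trans (sym s) t)
  functional {b = b} (inj₁ s)       (inj₂ (_ , t)) =
    contradiction (trans (sym s) t) (ℕ.<⇒≢ (Fin.toℕ<n b))
  functional {c = c} (inj₂ (_ , s)) (inj₁ t)       =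
    contradiction (trans (sym t) s) (ℕ.<⇒≢ (Fin.toℕ<n c))
  functional         (inj₂ (z , _)) (inj₂ (y , _)) = Fin.toℕ-injective (trans z (sym y))

  injective : ∀ {a b c : Fin m} → a ↻ c → b ↻ c → a ≡ b
  injective (inj₁ s)       (inj₁ t)       = Fin.toℕ-injective (ℕ.suc-injective (trans s (sym t)))
  injective (inj₁ s)       (inj₂ (z , _)) = contradiction (trans s z) λ ()
  injective (inj₂ (z , _)) (inj₁ s)       = contradiction (trans s z) λ ()
  injective (inj₂ (_ , s)) (inj₂ (_ , t)) = Fin.toℕ-injective (ℕ.suc-injective (trans s (sym t)))

  -- Returning after two steps raises the index by two if no step wraps around, and otherwise forces
  -- `m` to be 2 (one wrap) or 1 (two wraps).
  two : ∀ {a b : Fin m} → a ↻ b → ¬ b ↻ a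
  two (inj₁ s)       (inj₁ t)       = ℕ.m≢1+n+m _ {1} (sym (trans (cong suc s) t))
  two (inj₁ s)       (inj₂ (z , t)) =
    m≢ 2 ℕ.≤-refl (trans (cong suc (trans (cong suc (sym z)) s)) t)
  two (inj₂ (z , s)) (inj₁ t)       =
    m≢ 2 ℕ.≤-refl (trans (cong suc (trans (cong suc (sym z)) t)) s)
  two (inj₂ (_ , s)) (inj₂ (z , _)) = m≢ 1 (s≤s z≤n) (trans (cong suc (sym z)) s)

module Ladder {m : ℕ} where
  open Track (ladderTrack {m}) public
  open Neighborhood (ladderTrack {m}) ladderEdge? ladderEdge-irrefl public

module Prism {m : ℕ} (m≥3 : 3 ≤ m) where
  open Track (prismTrack m≥3) public
  open Neighborhood (prismTrack m≥3) prismEdge? (prismEdge-irrefl m≥3) public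

-- Dead columns and the invariant of play on the ladder.

interior : ∀ {m} (b : Fin (suc m)) → toℕ b ≢ 0 → toℕ b ≢ m →
           ∃₂ λ a c → Track._↝_ ladderTrack a b × Track._↝_ ladderTrack b c
interior zero    b≢0 _   = contradiction refl b≢0
interior (suc a) _   b≢m =
  inject₁ a , fromℕ< b<m , cong suc (Fin.toℕ-inject₁ a) , sym (Fin.toℕ-fromℕ< b<m)
  where b<m = s≤s (ℕ.≤∧≢⇒< (Fin.toℕ<n a) b≢m)

-- The condition `dead a ≢ dead c` encodes exactly one dead neighbor. If both neighbors are dead,
-- `blank` already puts a zero on either side of every vertex of the column.
record Sealed {m} (dead : Fin (suc m) → Bool) (g : Grid (suc m) → Bool) : Set where
  open Ladder {suc m} using (_↝_)
  field
    first   : ∀ {k} → toℕ k ≡ 0 → dead k ≡ true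
    last    : ∀ {k} → toℕ k ≡ m → dead k ≡ true
    blank   : ∀ {k} → dead k ≡ true → ∀ i → g (i , k) ≡ true
    full    : ∀ {a b c} → a ↝ b → b ↝ c → dead a ≡ false → dead b ≡ false → dead c ≡ false →
              ∀ i → g (i , b) ≡ false
    partial : ∀ {a b c} → a ↝ b → b ↝ c → dead b ≡ false → dead a ≢ dead c →
              ∃ λ i → g (i , b) ≡ true

  alive⇒≢first : ∀ {k} → dead k ≡ false → toℕ k ≢ 0
  alive⇒≢first alive k≡0 = contradiction (trans (sym (first k≡0)) alive) λ ()

  alive⇒≢last : ∀ {k} → dead k ≡ false → toℕ k ≢ m
  alive⇒≢last alive k≡m = contradiction (trans (sym (last k≡m)) alive) λ ()

  legal⇒alive : ∀ {i k} → Legal ⟨ ℒ₂ (suc m) , g ⟩ (i , k) → dead k ≡ false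
  legal⇒alive {i} {k} (w≡1 , _) with dead k in eq
  ... | false = refl
  ... | true  = contradiction (trans (sym (cong wt (blank eq i))) w≡1) λ ()

  module _ {a b c : Fin (suc m)} {i : Fin 2} (a↝b : a ↝ b) (b↝c : b ↝ c)
           (legal : Legal ⟨ ℒ₂ (suc m) , g ⟩ (i , b)) where
    private
      fav = Ladder.Legal⇒Favourable a↝b b↝c g i legal

      b-alive : dead b ≡ false
      b-alive = legal⇒alive legal

      -- The zero that `partial` provides in column `b` cannot be the played vertex, which has
      -- weight 1, so it is its rung partner.
      opposite-zero : dead a ≢ dead c → g (opposite i , b) ≡ true
      opposite-zero a≢c with ∃⇒row⊎opposite i (partial a↝b b↝c b-alive a≢c)
      ... | inj₁ gib = contradiction (trans (sym gib) (Favourable⇒¬p fav)) λ ()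
      ... | inj₂ gob = gob

    -- A dead neighbor column contributes one zero to the cross. The second, forbidden zero is on
    -- the other side if that column is dead too, and is the rung partner otherwise.
    legal⇒neighbors-alive : dead a ≡ false × dead c ≡ false
    legal⇒neighbors-alive with dead a in a≡ | dead c in c≡
    ... | false | false = refl , refl
    ... | true  | true  = contradiction (blank c≡ i) (Favourable⇒¬[r∧s] fav (blank a≡ i))
    ... | true  | false = contradiction (blank a≡ i) (Favourable⇒¬[q∧r] fav
                            (opposite-zero λ eq → contradiction (trans (sym a≡) (trans eq c≡)) λ ()))
    ... | false | true  = contradiction (blank c≡ i) (Favourable⇒¬[q∧s] fav
                            (opposite-zero λ eq → contradiction (trans (sym a≡) (trans eq c≡)) λ ()))

kill : ∀ {n} → Fin n → (Fin n → Bool) → Fin n → Bool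
kill b dead k = does (k Fin.≟ b) ∨ dead k

module Kill {n} (b : Fin n) (dead : Fin n → Bool) where

  kill-self : kill b dead b ≡ true
  kill-self rewrite dec-true (b Fin.≟ b) refl = refl

  kill-≢ : ∀ {k} → k ≢ b → kill b dead k ≡ dead k
  kill-≢ {k} k≢b rewrite dec-false (k Fin.≟ b) k≢b = refl

  kill-mono : ∀ {k} → dead k ≡ true → kill b dead k ≡ true
  kill-mono {k} eq rewrite eq = ∨-zeroʳ (does (k Fin.≟ b))

  kill-false : ∀ {k} → kill b dead k ≡ false → k ≢ b × dead k ≡ false
  kill-false {k} eq with k Fin.≟ b
  ... | no k≢b = k≢b , eq

-- The columns next to a killed column are alive and, unless a second
-- dead column is two steps away, were full before the move, so each of
-- them gains exactly one zero.
switch-sealed : ∀ {m dead} {g : Grid (suc m) → Bool} {i b} → Sealed dead g →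
                Legal ⟨ ℒ₂ (suc m) , g ⟩ (i , b) →
                Sealed (kill b dead) (V₀ (switch ⟨ ℒ₂ (suc m) , g ⟩ (i , b)))
switch-sealed {m} {dead} {g} {i} {b} sealed legal = record
  { first   = λ k≡0 → Kill.kill-mono b dead (first k≡0)
  ; last    = λ k≡m → Kill.kill-mono b dead (last k≡m)
  ; blank   = blank′
  ; full    = full′
  ; partial = partial′
  }
  where
  open Sealed sealed
  open Ladder {suc m}
  open Kill b dead

  S : Position
  S = ⟨ ℒ₂ (suc m) , g ⟩

  b-alive : dead b ≡ false
  b-alive = legal⇒alive legal

  neighbors = interior b (alive⇒≢first b-alive) (alive⇒≢last b-alive)
  a = proj₁ neighbors
  c = proj₁ (proj₂ neighbors)
  a↝b : a ↝ b
  a↝b = proj₁ (proj₂ (proj₂ neighbors))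
  b↝c : b ↝ c
  b↝c = proj₂ (proj₂ (proj₂ neighbors))

  a-alive : dead a ≡ false
  a-alive = proj₁ (legal⇒neighbors-alive a↝b b↝c legal)
  c-alive : dead c ≡ false
  c-alive = proj₂ (legal⇒neighbors-alive a↝b b↝c legal)

  unchanged : ∀ {i′ k} → k ≢ a → k ≢ b → k ≢ c → V₀ (switch S (i , b)) (i′ , k) ≡ g (i′ , k)
  unchanged k≢a k≢b k≢c = switch-∉ S λ w∈N → outside (∈N⇒row⊎column w∈N)
    where
    outside : ¬ _
    outside (inj₁ k≡b)              = k≢b k≡b
    outside (inj₂ (_ , inj₁ b↝k)) = k≢c (↝-functional b↝k b↝c)
    outside (inj₂ (_ , inj₂ k↝b)) = k≢a (↝-injective k↝b a↝b)

  alive≢dead : ∀ {k l} → dead k ≡ true → dead l ≡ false → k ≢ l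
  alive≢dead k-dead l-alive refl = contradiction (trans (sym k-dead) l-alive) λ ()

  blank′ : ∀ {k} → kill b dead k ≡ true → ∀ i′ → V₀ (switch S (i , b)) (i′ , k) ≡ true
  blank′ {k} killed i′ with k Fin.≟ b
  ... | yes refl = trans (switch-∈ S ∈N-column)
                     (cong not (full a↝b b↝c a-alive b-alive c-alive i′))
  ... | no k≢b = trans (unchanged (alive≢dead killed a-alive) k≢b (alive≢dead killed c-alive))
                       (blank killed i′)

  full′ : ∀ {a′ b′ c′} → a′ ↝ b′ → b′ ↝ c′ → kill b dead a′ ≡ false → kill b dead b′ ≡ false →
          kill b dead c′ ≡ false → ∀ i′ → V₀ (switch S (i , b)) (i′ , b′) ≡ false
  full′ {a′} {b′} {c′} p q a′-alive b′-alive c′-alive i′ =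
    let a′≢b , a″ = kill-false a′-alive
        b′≢b , b″ = kill-false b′-alive
        c′≢b , c″ = kill-false c′-alive
    -- If `b′` were `a` or `c`, one of its own neighbors would be the killed column `b`.
    in trans (unchanged (λ { refl → c′≢b (↝-functional q a↝b) }) b′≢b
                        (λ { refl → a′≢b (↝-injective p b↝c) }))
             (full p q a″ b″ c″ i′)

  partial′ : ∀ {a′ b′ c′} → a′ ↝ b′ → b′ ↝ c′ → kill b dead b′ ≡ false →
             kill b dead a′ ≢ kill b dead c′ → ∃ λ i′ → V₀ (switch S (i , b)) (i′ , b′) ≡ true
  partial′ {a′} {b′} {c′} p q b′-alive a′≢c′ with kill-false b′-alive
  ... | b′≢b , b″ with b′ Fin.≟ a | b′ Fin.≟ c
  ... | yes refl | _ with refl ← ↝-functional q a↝b =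
    i , trans (switch-∈ S (∈N-previous a↝b)) (cong not (full p a↝b a″ a-alive b-alive i))
    where
    a″ : dead a′ ≡ false
    a″ = proj₂ (kill-false (¬-not λ eq → a′≢c′ (trans eq (sym kill-self))))
  ... | no _ | yes refl with refl ← ↝-injective p b↝c =
    i , trans (switch-∈ S (∈N-next b↝c)) (cong not (full b↝c q b-alive c-alive c″ i))
    where
    c″ : dead c′ ≡ false
    c″ = proj₂ (kill-false (¬-not λ eq → a′≢c′ (trans kill-self (sym eq))))
  -- Away from `a` and `c`, neither neighbor of `b′` is `b`: their flags are as before, and the old
  -- zero survives.
  ... | no b′≢a | no b′≢c =
    let a′≢b : a′ ≢ b
        a′≢b = λ { refl → b′≢c (↝-functional p b↝c) }
        c′≢b : c′ ≢ b
        c′≢b = λ { refl → b′≢a (↝-injective q a↝b) }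
        i′ , zero′ = partial p q b″ λ eq →
          a′≢c′ (trans (kill-≢ a′≢b) (trans eq (sym (kill-≢ c′≢b))))
    in i′ , trans (unchanged b′≢a b′≢b b′≢c) zero′

-- Wrapping the ladder around the prism and transferring moves.

flip : Fin 2 → Fin 2 → Fin 2
flip zero       i = opposite i
flip (suc zero) i = i

flip-involutive : ∀ r i → flip r (flip r i) ≡ i
flip-involutive zero       zero       = refl
flip-involutive zero       (suc zero) = refl
flip-involutive (suc zero) i          = refl

flip-opposite : ∀ r i → flip r (opposite i) ≡ opposite (flip r i)
flip-opposite zero       i = refl
flip-opposite (suc zero) i = refl

-- Row 1 is the row of `ℋ` with additional zeros next to the ends, so it has to land on the row `r`
-- of the played vertex.
flip-fixes-1 : ∀ r → flip r (suc zero) ≡ r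
flip-fixes-1 zero       = refl
flip-fixes-1 (suc zero) = refl

flip≡⇒1 : ∀ r {i} → flip r i ≡ r → i ≡ suc zero
flip≡⇒1 zero       {suc zero} refl = refl
flip≡⇒1 (suc zero)            refl = refl

flip-injective : ∀ r {i j} → flip r i ≡ flip r j → i ≡ j
flip-injective r {i} {j} eq =
  trans (sym (flip-involutive r i)) (trans (cong (flip r) eq) (flip-involutive r j))

map-cross : ∀ {m n} r (ψ : Fin m → Fin n) i {a b c} →
            cross (flip r i) (ψ a) (ψ b) (ψ c) ≡ map (λ (i , k) → flip r i , ψ k) (cross i a b c)
map-cross r ψ i {b = b} rewrite flip-opposite r i = refl

cross-column : ∀ {m} {P : Fin m → Set} {i a b c w} → P a → P b → P c →
               w ∈ cross i a b c → P (proj₂ w)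
cross-column pa pb pc (here refl)                         = pb
cross-column pa pb pc (there (here refl))                 = pb
cross-column pa pb pc (there (there (here refl)))         = pa
cross-column pa pb pc (there (there (there (here refl)))) = pc

-- The ladder wraps around the prism once, starting and ending at the
-- column of v₀, and with row 1 mapped to the row of v₀.
module Wrapping {m : ℕ} (m≥3 : 3 ≤ m) (v₀ : Grid m) where
  open Ladder {suc m} using (_↝_)
  private
    module L = Ladder {suc m}
    module P = Prism m≥3

    r : Fin 2
    r = proj₁ v₀

    s : Fin m
    s = proj₂ v₀

    -- The residue of `j + s` modulo `m`; two cases suffice because the sum is below `2 * m`.
    Wraps : Fin (suc m) → Fin m → Set
    Wraps j k = toℕ k ≡ toℕ j + toℕ s ⊎ toℕ k + m ≡ toℕ j + toℕ s

    wrap : ∀ j → ∃ (Wraps j)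
    wrap j with toℕ j + toℕ s ℕ.<? m
    ... | yes j+s<m = fromℕ< j+s<m , inj₁ (Fin.toℕ-fromℕ< j+s<m)
    ... | no  j+s≮m =
      fromℕ< k<m , inj₂ (trans (cong (_+ m) (Fin.toℕ-fromℕ< k<m)) (ℕ.m∸n+n≡m m≤j+s))
      where
      m≤j+s = ℕ.≮⇒≥ j+s≮m
      k<m : toℕ j + toℕ s ∸ m < m
      k<m = ℕ.+-cancelʳ-< m _ m (ℕ.≤-<-trans (ℕ.≤-reflexive (ℕ.m∸n+n≡m m≤j+s))
              (ℕ.+-mono-≤-< (ℕ.≤-pred (Fin.toℕ<n j)) (Fin.toℕ<n s)))

    +m-absurd : ∀ {A : Set} (k : Fin m) n → toℕ k ≡ n + m → A
    +m-absurd k n eq =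
      contradiction (ℕ.≤-trans (ℕ.m≤n+m m n) (ℕ.≤-reflexive (sym eq))) (ℕ.<⇒≱ (Fin.toℕ<n k))

    Wraps-functional : ∀ {j k k′} → Wraps j k → Wraps j k′ → k ≡ k′
    Wraps-functional                  (inj₁ p) (inj₁ q) = Fin.toℕ-injective (trans p (sym q))
    Wraps-functional {k = k} {k′}     (inj₁ p) (inj₂ q) = +m-absurd k (toℕ k′) (trans p (sym q))
    Wraps-functional {k = k} {k′}     (inj₂ p) (inj₁ q) = +m-absurd k′ (toℕ k) (trans q (sym p))
    Wraps-functional {k = k} {k′}     (inj₂ p) (inj₂ q) =
      Fin.toℕ-injective (ℕ.+-cancelʳ-≡ m (toℕ k) (toℕ k′) (trans p (sym q)))

    j+s+m≡ : ∀ x → x + toℕ s + m ≡ x + m + toℕ s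
    j+s+m≡ x = trans (ℕ.+-assoc x _ m)
      (trans (cong (x +_) (ℕ.+-comm (toℕ s) m)) (sym (ℕ.+-assoc x m _)))

    -- Columns over the same `k` differ by 0 or by `m`. Among the indices from 0 to `m`, a
    -- difference of `m` occurs only between the two ends, and `z` is not an end.
    Wraps-injective : ∀ {j z k} → toℕ z ≢ 0 → toℕ z ≢ m → Wraps j k → Wraps z k → j ≡ z
    Wraps-injective _ _ (inj₁ p) (inj₁ q) =
      Fin.toℕ-injective (ℕ.+-cancelʳ-≡ (toℕ s) _ _ (trans (sym p) q))
    Wraps-injective _ _ (inj₂ p) (inj₂ q) =
      Fin.toℕ-injective (ℕ.+-cancelʳ-≡ (toℕ s) _ _ (trans (sym p) q))
    Wraps-injective {j} {z} z≢0 z≢m (inj₁ p) (inj₂ q) =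
      contradiction (ℕ.≤-antisym (ℕ.≤-pred (Fin.toℕ<n z))
        (ℕ.≤-trans (ℕ.m≤n+m m (toℕ j)) (ℕ.≤-reflexive (ℕ.+-cancelʳ-≡ (toℕ s) _ _
          (trans (sym (j+s+m≡ (toℕ j))) (trans (cong (_+ m) (sym p)) q)))))) z≢m
    Wraps-injective {j} {z} z≢0 z≢m (inj₂ p) (inj₁ q) =
      contradiction (ℕ.n≤0⇒n≡0 (ℕ.+-cancelʳ-≤ m (toℕ z) 0
        (ℕ.≤-trans (ℕ.≤-reflexive (ℕ.+-cancelʳ-≡ (toℕ s) _ _
          (trans (sym (j+s+m≡ (toℕ z))) (trans (cong (_+ m) (sym q)) p))))
          (ℕ.≤-pred (Fin.toℕ<n j))))) z≢0

  ψ : Fin (suc m) → Fin m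
  ψ j = proj₁ (wrap j)

  φ : Grid (suc m) → Grid m
  φ (i , j) = flip r i , ψ j

  ψ-surjective : ∀ k → ∃ λ j → ψ j ≡ k
  ψ-surjective k with ℕ.≤-total (toℕ s) (toℕ k)
  ... | inj₁ s≤k = j , Wraps-functional (proj₂ (wrap j))
                         (inj₁ (sym (trans (cong (_+ toℕ s) (Fin.toℕ-fromℕ< j<)) (ℕ.m∸n+n≡m s≤k))))
    where
    j< : toℕ k ∸ toℕ s < suc m
    j< = s≤s (ℕ.≤-trans (ℕ.m∸n≤m (toℕ k) (toℕ s)) (ℕ.<⇒≤ (Fin.toℕ<n k)))
    j = fromℕ< j<
  ... | inj₂ k≤s = j , Wraps-functional (proj₂ (wrap j))
                         (inj₂ (sym (trans (cong (_+ toℕ s) (Fin.toℕ-fromℕ< j<))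
                           (ℕ.m∸n+n≡m (ℕ.≤-trans (ℕ.<⇒≤ (Fin.toℕ<n s)) (ℕ.m≤n+m m (toℕ k)))))))
    where
    j< : toℕ k + m ∸ toℕ s < suc m
    j< = s≤s (ℕ.m≤n+o⇒m∸n≤o (toℕ k + m) (toℕ s) (ℕ.+-monoˡ-≤ m k≤s))
    j = fromℕ< j<

  φ-surjective : ∀ u → ∃ λ x → φ x ≡ u
  φ-surjective (i , k) =
    let j , ψj≡k = ψ-surjective k
    in (flip r i , j) , cong₂ _,_ (flip-involutive r i) ψj≡k

  ψ-injective : ∀ {j z} → toℕ z ≢ 0 → toℕ z ≢ m → ψ j ≡ ψ z → j ≡ z
  ψ-injective {j} {z} z≢0 z≢m eq =
    Wraps-injective z≢0 z≢m (subst (Wraps j) eq (proj₂ (wrap j))) (proj₂ (wrap z))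

  φ-injective : ∀ {x y} → toℕ (proj₂ y) ≢ 0 → toℕ (proj₂ y) ≢ m → φ x ≡ φ y → x ≡ y
  φ-injective y≢0 y≢m eq =
    cong₂ _,_ (flip-injective r (cong proj₁ eq)) (ψ-injective y≢0 y≢m (cong proj₂ eq))

  ψ-end : ∀ {j} → toℕ j ≡ 0 ⊎ toℕ j ≡ m → ψ j ≡ s
  ψ-end {j} (inj₁ j≡0) = Wraps-functional (proj₂ (wrap j)) (inj₁ (cong (_+ toℕ s) (sym j≡0)))
  ψ-end {j} (inj₂ j≡m) = Wraps-functional (proj₂ (wrap j))
    (inj₂ (trans (ℕ.+-comm (toℕ s) m) (cong (_+ toℕ s) (sym j≡m))))

  ψ-end⁻ : ∀ {j} → ψ j ≡ s → toℕ j ≡ 0 ⊎ toℕ j ≡ m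
  ψ-end⁻ {j} eq with subst (Wraps j) eq (proj₂ (wrap j))
  ... | inj₁ s≡j+s   = inj₁ (ℕ.+-cancelʳ-≡ (toℕ s) _ 0 (sym s≡j+s))
  ... | inj₂ s+m≡j+s = inj₂ (ℕ.+-cancelʳ-≡ (toℕ s) _ _ (trans (sym s+m≡j+s) (ℕ.+-comm (toℕ s) m)))

  ψ-↝ : ∀ {a b} → a ↝ b → ψ a P.↝ ψ b
  ψ-↝ {a} {b} a↝b with wrap a | wrap b
  ... | k , inj₁ p | k′ , inj₁ q = inj₁ (trans (cong suc p) (trans (cong (_+ toℕ s) a↝b) (sym q)))
  ... | k , inj₂ p | k′ , inj₂ q =
    inj₁ (ℕ.+-cancelʳ-≡ m _ _ (trans (cong suc p) (trans (cong (_+ toℕ s) a↝b) (sym q))))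
  ... | k , inj₂ p | k′ , inj₁ q =
    +m-absurd k′ (suc (toℕ k)) (trans q (trans (cong (_+ toℕ s) (sym a↝b)) (cong suc (sym p))))
  -- The step across the seam: `suc k` equals `k′ + m` and is at most `m`, so `k` is the last column
  -- and `k′` is column 0.
  ... | k , inj₁ p | k′ , inj₂ q = inj₂ (k′≡0 , trans suc-k≡ (cong (_+ m) k′≡0))
    where
    suc-k≡ : suc (toℕ k) ≡ toℕ k′ + m
    suc-k≡ = trans (cong suc p) (trans (cong (_+ toℕ s) a↝b) (sym q))
    k′≡0 : toℕ k′ ≡ 0
    k′≡0 = ℕ.n≤0⇒n≡0 (ℕ.+-cancelʳ-≤ m _ 0
             (ℕ.≤-trans (ℕ.≤-reflexive (sym suc-k≡)) (Fin.toℕ<n k)))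

  prism : (Grid m → Bool) → Position
  prism f = ⟨ P[ m ,1] m≥3 , f ⟩

  ladder : (Grid (suc m) → Bool) → Position
  ladder g = ⟨ ℒ₂ (suc m) , g ⟩

  module _ {f : Grid m → Bool} {g : Grid (suc m) → Bool} (f∘φ≗g : ∀ x → f (φ x) ≡ g x) where

    private
      f-opposite : ∀ i b → f (opposite (flip r i) , ψ b) ≡ g (opposite i , b)
      f-opposite i b = trans (cong (λ i′ → f (i′ , ψ b)) (sym (flip-opposite r i))) (f∘φ≗g _)

    module _ {i : Fin 2} {a b c : Fin (suc m)} (a↝b : a ↝ b) (b↝c : b ↝ c) where

      -- Legality depends only on the four flags of a cross, and `φ` carries crosses to crosses with
      -- equal flags.
      Legal-φ⁺ : Legal (ladder g) (i , b) → Legal (prism f) (φ (i , b))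
      Legal-φ⁺ legal = P.Favourable⇒Legal (ψ-↝ a↝b) (ψ-↝ b↝c) f (flip r i)
        (Favourable-cong (sym (f∘φ≗g _)) (sym (f-opposite i b)) (sym (f∘φ≗g _)) (sym (f∘φ≗g _))
          (L.Legal⇒Favourable a↝b b↝c g i legal))

      Legal-φ⁻ : Legal (prism f) (φ (i , b)) → Legal (ladder g) (i , b)
      Legal-φ⁻ legal = L.Favourable⇒Legal a↝b b↝c g i
        (Favourable-cong (f∘φ≗g _) (f-opposite i b) (f∘φ≗g _) (f∘φ≗g _)
          (P.Legal⇒Favourable (ψ-↝ a↝b) (ψ-↝ b↝c) f (flip r i) legal))

      module _ {dead : Fin (suc m) → Bool} (sealed : Sealed dead g)
               (legal : Legal (ladder g) (i , b)) where
        open Sealed sealed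
        private
          Inner : Fin (suc m) → Set
          Inner k = toℕ k ≢ 0 × toℕ k ≢ m

          alive⇒inner : ∀ {k} → dead k ≡ false → Inner k
          alive⇒inner alive = alive⇒≢first alive , alive⇒≢last alive

          neighbors-alive = legal⇒neighbors-alive a↝b b↝c legal

          cross-inner : ∀ {w} → w ∈ cross i a b c → Inner (proj₂ w)
          cross-inner {w} = cross-column {P = Inner} {w = w} (alive⇒inner (proj₁ neighbors-alive))
            (alive⇒inner (legal⇒alive legal)) (alive⇒inner (proj₂ neighbors-alive))

          φ-cross⁺ : ∀ {y} → y ∈ cross i a b c → φ y ∈ cross (flip r i) (ψ a) (ψ b) (ψ c)
          φ-cross⁺ {y} y∈ = subst (φ y ∈_) (sym (map-cross r ψ i)) (∈-map⁺ φ y∈)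

          φ-cross⁻ : ∀ {y} → φ y ∈ cross (flip r i) (ψ a) (ψ b) (ψ c) → y ∈ cross i a b c
          φ-cross⁻ {y} φy∈ =
            let z , z∈ , φy≡φz = ∈-map⁻ φ (subst (φ y ∈_) (map-cross r ψ i) φy∈)
                z≢0 , z≢m = cross-inner z∈
            in subst (_∈ cross i a b c) (sym (φ-injective z≢0 z≢m φy≡φz)) z∈

        -- The cross of a legal move lies in alive, hence interior, columns. There no second vertex
        -- of the ladder has the same image, so `y` is switched exactly when `φ y` is.
        switch-φ : ∀ y → V₀ (switch (prism f) (φ (i , b))) (φ y) ≡ V₀ (switch (ladder g) (i , b)) y
        switch-φ y = by-membership (Graph._∈N[_]? (ℒ₂ (suc m)) y (i , b))
          where
          by-membership : Dec (Graph._∈N[_] (ℒ₂ (suc m)) y (i , b)) →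
            V₀ (switch (prism f) (φ (i , b))) (φ y) ≡ V₀ (switch (ladder g) (i , b)) y
          by-membership (yes y∈N) =
            trans (switch-∈ (prism f)
                    (P.∈cross⇒∈N (ψ-↝ a↝b) (ψ-↝ b↝c) (φ-cross⁺ (L.∈N⇒∈cross a↝b b↝c y∈N))))
                  (trans (cong not (f∘φ≗g y)) (sym (switch-∈ (ladder g) y∈N)))
          by-membership (no y∉N) =
            trans (switch-∉ (prism f) λ φy∈N →
                    y∉N (L.∈cross⇒∈N a↝b b↝c (φ-cross⁻ (P.∈N⇒∈cross (ψ-↝ a↝b) (ψ-↝ b↝c) φy∈N))))
                  (trans (f∘φ≗g y) (sym (switch-∉ (ladder g) y∉N)))

  -- Induction along ladder moves: `switch-sealed` and `switch-φ` restore both hypotheses after each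
  -- pair of corresponding moves.
  𝒢-prism≡𝒢-ladder : ∀ {f g dead} → Acc _◁_ (ladder g) → Sealed dead g → (∀ x → f (φ x) ≡ g x) →
                      𝒢 (prism f) ≡ 𝒢 (ladder g)
  𝒢-prism≡𝒢-ladder {f} {g} {dead} (acc below) sealed f∘φ≗g =
    𝒢-cong (prism f) (ladder g) descend ascend
    where
    open Sealed sealed

    neighbors : ∀ {k} → dead k ≡ false → ∃₂ λ a c → a ↝ k × k ↝ c
    neighbors alive = interior _ (alive⇒≢first alive) (alive⇒≢last alive)

    after : ∀ x → Legal (ladder g) x → 𝒢 (switch (prism f) (φ x)) ≡ 𝒢 (switch (ladder g) x)
    after (i , b) legal =
      let a , c , a↝b , b↝c = neighbors (legal⇒alive legal)
      in 𝒢-prism≡𝒢-ladder {V₀ (switch (prism f) (φ (i , b)))} {V₀ (switch (ladder g) (i , b))}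
           {kill b dead} (below (move legal)) (switch-sealed sealed legal)
           (switch-φ {f} {g} f∘φ≗g a↝b b↝c sealed legal)

    ascend : ∀ x → Legal (ladder g) x → ∃ λ u → Legal (prism f) u ×
             𝒢 (switch (ladder g) x) ≡ 𝒢 (switch (prism f) u)
    ascend x legal =
      let a , c , a↝b , b↝c = neighbors (legal⇒alive legal)
      in φ x , Legal-φ⁺ f∘φ≗g a↝b b↝c legal , sym (after x legal)

    descend-φ : ∀ x → Legal (prism f) (φ x) → ∃ λ y → Legal (ladder g) y ×
                𝒢 (switch (prism f) (φ x)) ≡ 𝒢 (switch (ladder g) y)
    descend-φ (i , b) legal =
      let a , c , a↝b , b↝c = neighbors alive
          legal′ = Legal-φ⁻ f∘φ≗g a↝b b↝c legal
      in (i , b) , legal′ , after (i , b) legal′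
      where
      alive : dead b ≡ false
      -- A dead column is blank, so its image in the prism has weight 0 and cannot be played.
      alive = ¬-not λ b-dead → contradiction
        (trans (sym (cong wt (trans (f∘φ≗g (i , b)) (blank b-dead i)))) (proj₁ legal)) λ ()

    descend : ∀ u → Legal (prism f) u → ∃ λ y → Legal (ladder g) y ×
              𝒢 (switch (prism f) u) ≡ 𝒢 (switch (ladder g) y)
    descend u =
      let x , φx≡u = φ-surjective u
      in subst (λ u → Legal (prism f) u → ∃ λ y → Legal (ladder g) y ×
                      𝒢 (switch (prism f) u) ≡ 𝒢 (switch (ladder g) y))
               φx≡u (descend-φ x)

-- The zero set of `ℋ`, with columns counted from 0, and its invariant.

Corner : ∀ {m} → Grid (suc m) → Set
Corner {m} (i , j) =
  (toℕ j ≡ 0 ⊎ toℕ j ≡ m) ⊎ (i ≡ suc zero × (toℕ j ≡ 1 ⊎ suc (toℕ j) ≡ m))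

module _ {m} (4≤1+m : 4 ≤ suc m) where
  open DecMembership (≡-dec ℕ._≟_ ℕ._≟_) using (_∈?_)
  private
    corners : List (ℕ × ℕ)
    corners = (0 , 1) ∷ (0 , suc m) ∷ (1 , 1) ∷ (1 , 2) ∷ (1 , m) ∷ (1 , suc m) ∷ []

    ∈corners⇒Corner : ∀ (y : Grid (suc m)) → (row y , col y) ∈ corners → Corner y
    ∈corners⇒Corner y (here eq) = inj₁ (inj₁ (ℕ.suc-injective (cong proj₂ eq)))
    ∈corners⇒Corner y (there (here eq)) = inj₁ (inj₂ (ℕ.suc-injective (cong proj₂ eq)))
    ∈corners⇒Corner y (there (there (here eq))) = inj₁ (inj₁ (ℕ.suc-injective (cong proj₂ eq)))
    ∈corners⇒Corner y (there (there (there (here eq)))) =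
      inj₂ (Fin.toℕ-injective (cong proj₁ eq) , inj₁ (ℕ.suc-injective (cong proj₂ eq)))
    ∈corners⇒Corner y (there (there (there (there (here eq))))) =
      inj₂ (Fin.toℕ-injective (cong proj₁ eq) , inj₂ (cong proj₂ eq))
    ∈corners⇒Corner y (there (there (there (there (there (here eq)))))) =
      inj₁ (inj₂ (ℕ.suc-injective (cong proj₂ eq)))

    Corner⇒∈corners : ∀ (y : Grid (suc m)) → Corner y → (row y , col y) ∈ corners
    Corner⇒∈corners (zero , j) (inj₁ (inj₁ eq)) = here (cong (λ n → 0 , suc n) eq)
    Corner⇒∈corners (zero , j) (inj₁ (inj₂ eq)) = there (here (cong (λ n → 0 , suc n) eq))
    Corner⇒∈corners (suc zero , j) (inj₁ (inj₁ eq)) =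
      there (there (here (cong (λ n → 1 , suc n) eq)))
    Corner⇒∈corners (suc zero , j) (inj₁ (inj₂ eq)) =
      there (there (there (there (there (here (cong (λ n → 1 , suc n) eq))))))
    Corner⇒∈corners (suc zero , j) (inj₂ (_ , inj₁ eq)) =
      there (there (there (here (cong (λ n → 1 , suc n) eq))))
    Corner⇒∈corners (suc zero , j) (inj₂ (_ , inj₂ eq)) =
      there (there (there (there (here (cong (1 ,_) eq)))))

  Corner⇒V₀-ℋ : ∀ y → Corner y → V₀ (ℋ (suc m) 4≤1+m) y ≡ true
  Corner⇒V₀-ℋ y corner = dec-true ((row y , col y) ∈? corners) (Corner⇒∈corners y corner)

  ¬Corner⇒V₀-ℋ : ∀ y → ¬ Corner y → V₀ (ℋ (suc m) 4≤1+m) y ≡ false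
  ¬Corner⇒V₀-ℋ y ¬corner =
    dec-false ((row y , col y) ∈? corners) (¬corner ∘ ∈corners⇒Corner y)

end? : ∀ {m} (k : Fin (suc m)) → Dec (toℕ k ≡ 0 ⊎ toℕ k ≡ m)
end? {m} k = (toℕ k ℕ.≟ 0) ⊎-dec (toℕ k ℕ.≟ m)

ends : ∀ {m} → Fin (suc m) → Bool
ends k = does (end? k)

does≡true⇒ : ∀ {A : Set} (A? : Dec A) → does A? ≡ true → A
does≡true⇒ (yes a) _ = a

does≡false⇒¬ : ∀ {A : Set} (A? : Dec A) → does A? ≡ false → ¬ A
does≡false⇒¬ (no ¬a) _ = ¬a

-- Only the two ends are dead at the start; the zeros of row 1 beside them are those that `partial`
-- asks for.
ℋ-sealed : ∀ {m} (4≤1+m : 4 ≤ suc m) → Sealed ends (V₀ (ℋ (suc m) 4≤1+m))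
ℋ-sealed {m} 4≤1+m = record
  { first   = λ {k} k≡0 → dec-true (end? k) (inj₁ k≡0)
  ; last    = λ {k} k≡m → dec-true (end? k) (inj₂ k≡m)
  ; blank   = λ {k} k-end i → Corner⇒V₀-ℋ 4≤1+m (i , k) (inj₁ (does≡true⇒ (end? k) k-end))
  ; full    = full
  ; partial = partial
  }
  where
  open Ladder {suc m} using (_↝_)
  g = V₀ (ℋ (suc m) 4≤1+m)

  full : ∀ {a b c} → a ↝ b → b ↝ c → ends a ≡ false → ends b ≡ false → ends c ≡ false →
         ∀ i → g (i , b) ≡ false
  full {a} {b} {c} a↝b b↝c a-inner b-inner c-inner i = ¬Corner⇒V₀-ℋ 4≤1+m (i , b) λ where
    (inj₁ b-end)            → does≡false⇒¬ (end? b) b-inner b-end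
    (inj₂ (_ , inj₁ b≡1))   →
      does≡false⇒¬ (end? a) a-inner (inj₁ (ℕ.suc-injective (trans a↝b b≡1)))
    (inj₂ (_ , inj₂ 1+b≡m)) → does≡false⇒¬ (end? c) c-inner (inj₂ (trans (sym b↝c) 1+b≡m))

  partial : ∀ {a b c} → a ↝ b → b ↝ c → ends b ≡ false → ends a ≢ ends c → ∃ λ i → g (i , b) ≡ true
  partial {a} {b} {c} a↝b b↝c _ a≢c =
    suc zero , Corner⇒V₀-ℋ 4≤1+m (suc zero , b) (corner (end? a) (end? c) a≢c)
    where
    corner : (a? : Dec (toℕ a ≡ 0 ⊎ toℕ a ≡ m)) (c? : Dec (toℕ c ≡ 0 ⊎ toℕ c ≡ m)) →
             does a? ≢ does c? → Corner (suc zero , b)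
    corner (yes (inj₁ a≡0)) _ _ = inj₂ (refl , inj₁ (trans (sym a↝b) (cong suc a≡0)))
    -- The last column has no successor; below, likewise, the first has no predecessor.
    corner (yes (inj₂ a≡m)) _ _ =
      contradiction (ℕ.≤-trans (ℕ.≤-reflexive (trans (cong suc (sym a≡m)) a↝b))
                               (ℕ.≤-pred (Fin.toℕ<n b))) ℕ.1+n≰n
    corner (no _) (yes (inj₁ c≡0)) _ = contradiction (trans b↝c c≡0) λ ()
    corner (no _) (yes (inj₂ c≡m)) _ = inj₂ (refl , inj₂ (trans b↝c c≡m))
    corner (no _) (no _) a≢c = contradiction refl a≢c

-- The first move on the prism.

module _ {m : ℕ} (m≥3 : 3 ≤ m) (v : Grid m) where
  open Wrapping m≥3 v
  private
    module P = Prism m≥3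
    module G = Graph (P[ m ,1] m≥3)

    4≤1+m : 4 ≤ suc m
    4≤1+m = s≤s m≥3

    r = proj₁ v
    s = proj₂ v

    m>1 : 1 < m
    m>1 = ℕ.≤-trans (s≤s (s≤s z≤n)) m≥3

    start one penultimate end : Fin (suc m)
    start       = zero
    one         = fromℕ< (s≤s (ℕ.<⇒≤ m>1))
    penultimate = fromℕ< (s≤s (ℕ.m∸n≤m m 1))
    end         = fromℕ m

    toℕ-one : toℕ one ≡ 1
    toℕ-one = Fin.toℕ-fromℕ< (s≤s (ℕ.<⇒≤ m>1))

    suc-toℕ-penultimate : suc (toℕ penultimate) ≡ m
    suc-toℕ-penultimate =
      trans (cong suc (Fin.toℕ-fromℕ< (s≤s (ℕ.m∸n≤m m 1)))) (ℕ.m+[n∸m]≡n (ℕ.<⇒≤ m>1))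

    -- Both ends of the ladder lie over `s`, so the columns beside them lie over the two cyclic
    -- neighbors of `s`.
    s↝one : s P.↝ ψ one
    s↝one = subst (P._↝ ψ one) (ψ-end (inj₁ refl)) (ψ-↝ {start} {one} (sym toℕ-one))

    penultimate↝s : ψ penultimate P.↝ s
    penultimate↝s = subst (ψ penultimate P.↝_) (ψ-end (inj₂ (Fin.toℕ-fromℕ m)))
      (ψ-↝ {penultimate} {end} (trans suc-toℕ-penultimate (sym (Fin.toℕ-fromℕ m))))

    Corner⇒∈N : ∀ y → Corner y → φ y G.∈N[ v ]
    Corner⇒∈N (i , j) (inj₁ j-end) =
      subst (λ k → (flip r i , k) G.∈N[ v ]) (sym (ψ-end j-end)) P.∈N-column
    Corner⇒∈N (_ , j) (inj₂ (refl , inj₁ j≡1))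
      with refl ← Fin.toℕ-injective {i = j} {one} (trans j≡1 (sym toℕ-one)) =
      subst (λ i → (i , ψ one) G.∈N[ v ]) (sym (flip-fixes-1 r)) (P.∈N-next s↝one)
    Corner⇒∈N (_ , j) (inj₂ (refl , inj₂ 1+j≡m))
      with refl ← Fin.toℕ-injective {i = j} {penultimate}
                    (ℕ.suc-injective (trans 1+j≡m (sym suc-toℕ-penultimate))) =
      subst (λ i → (i , ψ penultimate) G.∈N[ v ]) (sym (flip-fixes-1 r))
        (P.∈N-previous penultimate↝s)

    one-inner : toℕ one ≢ 0 × toℕ one ≢ m
    one-inner = (λ one≡0 → contradiction (trans (sym toℕ-one) one≡0) λ ()) ,
                (λ one≡m → ℕ.<⇒≢ m>1 (trans (sym toℕ-one) one≡m))

    penultimate-inner : toℕ penultimate ≢ 0 × toℕ penultimate ≢ m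
    penultimate-inner =
      (λ p≡0 → ℕ.<⇒≢ m>1 (trans (cong suc (sym p≡0)) suc-toℕ-penultimate)) ,
      (λ p≡m → ℕ.1+n≢n (trans suc-toℕ-penultimate (sym p≡m)))

    ∈N⇒Corner : ∀ y → φ y G.∈N[ v ] → Corner y
    ∈N⇒Corner (i , j) φy∈N with P.∈N⇒∈cross penultimate↝s s↝one φy∈N
    ... | here eq         = inj₁ (ψ-end⁻ (cong proj₂ eq))
    ... | there (here eq) = inj₁ (ψ-end⁻ (cong proj₂ eq))
    ... | there (there (here eq)) =
      inj₂ (flip≡⇒1 r (cong proj₁ eq) , inj₂ (trans (cong (suc ∘ toℕ) j≡p) suc-toℕ-penultimate))
      where j≡p = ψ-injective (proj₁ penultimate-inner) (proj₂ penultimate-inner) (cong proj₂ eq)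
    ... | there (there (there (here eq))) =
      inj₂ (flip≡⇒1 r (cong proj₁ eq) , inj₁ (trans (cong toℕ j≡1) toℕ-one))
      where j≡1 = ψ-injective (proj₁ one-inner) (proj₂ one-inner) (cong proj₂ eq)

    -- The `φ`-preimage of the closed neighborhood of `v` is the set of corners, and the switch
    -- turns exactly that neighborhood to weight 0.
    first-move : ∀ y → V₀ (switch ⟨ P[ m ,1] m≥3 , ∅ ⟩ v) (φ y) ≡ V₀ (ℋ (suc m) 4≤1+m) y
    first-move y = by-membership (φ y G.∈N[ v ]?)
      where
      by-membership : Dec (φ y G.∈N[ v ]) →
        V₀ (switch ⟨ P[ m ,1] m≥3 , ∅ ⟩ v) (φ y) ≡ V₀ (ℋ (suc m) 4≤1+m) y
      by-membership (yes φy∈N) =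
        trans (switch-∈ ⟨ P[ m ,1] m≥3 , ∅ ⟩ φy∈N) (sym (Corner⇒V₀-ℋ 4≤1+m y (∈N⇒Corner y φy∈N)))
      by-membership (no φy∉N) =
        trans (switch-∉ ⟨ P[ m ,1] m≥3 , ∅ ⟩ φy∉N) (sym (¬Corner⇒V₀-ℋ 4≤1+m y (φy∉N ∘ Corner⇒∈N y)))

  first-move-legal : Legal ⟨ P[ m ,1] m≥3 , ∅ ⟩ v
  first-move-legal =
    -- All four weights are 1, so the sum drops from 4 to 0.
    P.Favourable⇒Legal penultimate↝s s↝one ∅ r (refl , s≤s z≤n)

  𝒢-first-move : 𝒢 (switch ⟨ P[ m ,1] m≥3 , ∅ ⟩ v) ≡ 𝒢 (ℋ (suc m) (s≤s m≥3))
  𝒢-first-move =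
    𝒢-prism≡𝒢-ladder {V₀ (switch ⟨ P[ m ,1] m≥3 , ∅ ⟩ v)} {V₀ (ℋ (suc m) 4≤1+m)} {ends}
      (◁-wellFounded (ℋ (suc m) 4≤1+m)) (ℋ-sealed 4≤1+m) first-move

proposition3p1 : (m : ℕ) (m≥3 : 3 ≤ m) →
    𝒢 ⟨ P[ m ,1] m≥3 , ∅ ⟩ ≡ mex (tabulate {n = 2 * m} (λ (i : Fin (2 * m)) → 𝒢 (ℋ (suc m) (s≤s m≥3))))
proposition3p1 m m≥3 =
  -- Every first move has the same value, so any vertex can serve as `v₀`; the last argument shows
  -- that `2 * m` is positive.
  𝒢-all-moves≡ ⟨ P[ m ,1] m≥3 , ∅ ⟩ v₀ (first-move-legal m≥3 v₀)
    (𝒢 (ℋ (suc m) (s≤s m≥3))) (𝒢-first-move m≥3) (fromℕ< (ℕ.≤-trans 0<m (ℕ.m≤n*m m 2)))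
  where
  0<m : 0 < m
  0<m = ℕ.≤-trans (s≤s z≤n) m≥3

  v₀ : Grid m
  v₀ = zero , fromℕ< 0<m
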